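{- The calculus $\mathcal{C}_{\mathsf{WM}}$ is a calculus for the logic $\mathsf{WM}$: for every formula $\varphi\in\mathcal{L}$, $\vdash_{\mathsf{WM}}\varphi$ if and only if the sequent $\varphi^\circ$ is derivable in $\mathcal{C}_{\mathsf{WM}}$.
   Context: Language: $\mathcal{L}$ is generated by $\varphi ::= p \mid \bot \mid \varphi\wedge\varphi \mid \varphi\vee\varphi \mid \varphi\to\varphi \mid \Box\varphi \mid \Diamond\varphi$; $\neg\varphi := \varphi\to\bot$. Logic: $\mathsf{WM}$ is obtained by extending an axiomatisation of intuitionistic propositional logic over $\mathcal{L}$ with the rules "from $\varphi\to\psi$ infer $\Box\varphi\to\Box\psi$" and "from $\varphi\to\psi$ infer $\Diamond\varphi\to\Diamond\psi$" and the axiom $(\Box\varphi\wedge\Diamond\neg\varphi)\to\bot$, closed under modus ponens and uniform substitution. $\vdash_{\mathsf{WM}}\varphi$ means $\varphi$ is a theorem of $\mathsf{WM}$. Sequents: a marked formula is an input formula $\varphi^\bullet$ or an output formula $\varphi^\circ$ with $\varphi\in\mathcal{L}$. A block is $\{\Delta\}$ where $\Delta$ contains at most one marked formula; it is an input block if $\Delta=\varphi^\bullet$ or $\Delta$ is empty, and an output block if $\Delta=\varphi^\circ$. A sequent has the form $\Gamma=\Lambda,\Pi$ where $\Lambda$ is a finite multiset of input formulas and input blocks and $\Pi$ is empty, or one output formula $\varphi^\circ$, or one output block $\{\varphi^\circ\}$. Below $\Gamma$ ranges over sequents, $\Lambda$ over sequents with only input components, $|\Delta|$ is the number of formulas in $\Delta$,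 and all rule instances must consist of sequents. The output thinning $\Gamma^{\Downarrow}$ of $\Gamma$ is obtained by removing the output formula or the whole output block (if any), i.e. $(\Lambda,\Pi)^{\Downarrow}=\Lambda$. Rules of $\mathcal{C}_{\mathsf{WM}}$ (premisses / conclusion): $\bot^\bullet$: (no premiss) / $\Gamma,\bot^\bullet$. $\mathsf{id}$: (no premiss) / $\Lambda,p^\bullet,p^\circ$ ($p$ a proposition letter). $\wedge^\bullet$: $\Gamma,\varphi^\bullet,\psi^\bullet$ / $\Gamma,(\varphi\wedge\psi)^\bullet$. $\wedge^\circ$: $\Lambda,\varphi^\circ$ and $\Lambda,\psi^\circ$ / $\Lambda,(\varphi\wedge\psi)^\circ$. $\vee^\bullet$: $\Gamma,\varphi^\bullet$ and $\Gamma,\psi^\bullet$ / $\Gamma,(\varphi\vee\psi)^\bullet$. $\vee^\circ$: $\Lambda,\varphi^\circ$ / $\Lambda,(\varphi\vee\psi)^\circ$; and $\Lambda,\psi^\circ$ / $\Lambda,(\varphi\vee\psi)^\circ$. $\to^\bullet$: $\Gamma^{\Downarrow},(\varphi\to\psi)^\bullet,\varphi^\circ$ and $\Gamma,\psi^\bullet$ / $\Gamma,(\varphi\to\psi)^\bullet$. $\to^\circ$: $\Lambda,\varphi^\bullet,\psi^\circ$ / $\Lambda,(\varphi\to\psi)^\circ$. $\Box^\bullet$: $\Gamma,\{\varphi^\bullet\}$ / $\Gamma,(\Box\varphi)^\bullet$. $\Box^\circ$ ($|\Delta|\leq 1$): $\Delta,\varphi^\circ$ / $\Lambda,\{\Delta\},(\Box\varphi)^\circ$.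 $\Diamond^\bullet$ ($|\Delta|\leq 1$): $\varphi^\bullet,\Delta$ / $\Gamma,(\Diamond\varphi)^\bullet,\{\Delta\}$. $\Diamond^\circ$: $\Lambda,\{\varphi^\circ\}$ / $\Lambda,(\Diamond\varphi)^\circ$. -}

module Defs where

open import Data.Nat.Base using (ℕ)
open import Data.List.Base using (List; []; _∷_; [_])
open import Data.Maybe.Base using (Maybe; just; nothing)
open import Data.List.Relation.Binary.Permutation.Propositional using (_↭_)

infixl 9 _[_]ˢ
infixr 8 □_ ◇_ ¬_
infixr 7 _∧_
infixr 6 _∨_
infixr 5 _⊃_

data Formula : Set where
  var         : ℕ → Formula
  ⊥           : Formula
  _∧_ _∨_ _⊃_ : Formula → Formula → Formula
  □_ ◇_       : Formula → Formula

¬_ : Formula → Formula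
¬ A = A ⊃ ⊥

_[_]ˢ : Formula → (ℕ → Formula) → Formula
var p   [ σ ]ˢ = σ p
⊥       [ σ ]ˢ = ⊥
(A ∧ B) [ σ ]ˢ = A [ σ ]ˢ ∧ B [ σ ]ˢ
(A ∨ B) [ σ ]ˢ = A [ σ ]ˢ ∨ B [ σ ]ˢ
(A ⊃ B) [ σ ]ˢ = A [ σ ]ˢ ⊃ B [ σ ]ˢ
(□ A)   [ σ ]ˢ = □ (A [ σ ]ˢ)
(◇ A)   [ σ ]ˢ = ◇ (A [ σ ]ˢ)

infix 4 WM⊢_

data WM⊢_ : Formula → Set where
  ⊃-k  : ∀ {A B}   → WM⊢ A ⊃ B ⊃ A
  ⊃-s  : ∀ {A B C} → WM⊢ (A ⊃ B ⊃ C) ⊃ (A ⊃ B) ⊃ A ⊃ C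
  ∧-i  : ∀ {A B}   → WM⊢ A ⊃ B ⊃ A ∧ B
  ∧-e₁ : ∀ {A B}   → WM⊢ A ∧ B ⊃ A
  ∧-e₂ : ∀ {A B}   → WM⊢ A ∧ B ⊃ B
  ∨-i₁ : ∀ {A B}   → WM⊢ A ⊃ A ∨ B
  ∨-i₂ : ∀ {A B}   → WM⊢ B ⊃ A ∨ B
  ∨-e  : ∀ {A B C} → WM⊢ (A ⊃ C) ⊃ (B ⊃ C) ⊃ A ∨ B ⊃ C
  ⊥-e  : ∀ {A}     → WM⊢ ⊥ ⊃ A
  □◇-⊥ : ∀ {A}     → WM⊢ □ A ∧ ◇ (¬ A) ⊃ ⊥
  □-mono : ∀ {A B} → WM⊢ A ⊃ B → WM⊢ □ A ⊃ □ B
  ◇-mono : ∀ {A B} → WM⊢ A ⊃ B → WM⊢ ◇ A ⊃ ◇ B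
  mp     : ∀ {A B} → WM⊢ A ⊃ B → WM⊢ A → WM⊢ B
  subst  : ∀ {A} (σ : ℕ → Formula) → WM⊢ A → WM⊢ A [ σ ]ˢ

infix 8 _• _°

-- A block contains at most one marked formula, so an input block is either
-- empty, ⦅ nothing ⦆•, or of the form {A•}, ⦅ just A ⦆•.
data Input : Set where
  _•   : Formula → Input
  ⦅_⦆• : Maybe Formula → Input

data Output : Set where
  _°   : Formula → Output
  ⦅_⦆° : Formula → Output

infix 4 _⇒_
infix 3 C⊢_

-- Λ ⇒ Π is the sequent Λ , Π.  The list Λ stands for a multiset: C⊢_ is
-- closed under permutations of Λ.
record Sequent : Set where
  constructor _⇒_
  field
    inputs : List Input
    output : Maybe Output

optional• : Maybe Formula → List Input
optional• nothing  = []
optional• (just A) = [ A • ]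

-- In the rules a sequent Γ with arbitrary output is written Λ ⇒ Π.
data C⊢_ : Sequent → Set where
  exch : ∀ {Λ Λ′ Π} → Λ ↭ Λ′ → C⊢ Λ ⇒ Π → C⊢ Λ′ ⇒ Π
  ⊥•   : ∀ {Λ Π} → C⊢ ⊥ • ∷ Λ ⇒ Π
  id   : ∀ {Λ p} → C⊢ var p • ∷ Λ ⇒ just (var p °)
  ∧•   : ∀ {Λ Π A B} → C⊢ A • ∷ B • ∷ Λ ⇒ Π → C⊢ (A ∧ B) • ∷ Λ ⇒ Π
  ∧°   : ∀ {Λ A B} → C⊢ Λ ⇒ just (A °) → C⊢ Λ ⇒ just (B °) →
         C⊢ Λ ⇒ just ((A ∧ B) °)
  ∨•   : ∀ {Λ Π A B} → C⊢ A • ∷ Λ ⇒ Π → C⊢ B • ∷ Λ ⇒ Π →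
         C⊢ (A ∨ B) • ∷ Λ ⇒ Π
  ∨°₁  : ∀ {Λ A B} → C⊢ Λ ⇒ just (A °) → C⊢ Λ ⇒ just ((A ∨ B) °)
  ∨°₂  : ∀ {Λ A B} → C⊢ Λ ⇒ just (B °) → C⊢ Λ ⇒ just ((A ∨ B) °)
  -- The left premiss is Γ⇓ , (A ⊃ B)• , A°: the output thinning Γ⇓ of
  -- Γ = Λ , Π (dropping an output block whole) is just Λ.
  ⊃•   : ∀ {Λ Π A B} →
         C⊢ (A ⊃ B) • ∷ Λ ⇒ just (A °) → C⊢ B • ∷ Λ ⇒ Π →
         C⊢ (A ⊃ B) • ∷ Λ ⇒ Π
  ⊃°   : ∀ {Λ A B} → C⊢ A • ∷ Λ ⇒ just (B °) → C⊢ Λ ⇒ just ((A ⊃ B) °)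
  □•   : ∀ {Λ Π A} → C⊢ ⦅ just A ⦆• ∷ Λ ⇒ Π → C⊢ (□ A) • ∷ Λ ⇒ Π
  -- {Δ} has to be an input block, as the conclusion already has an output.
  □°   : ∀ {Λ A} (Δ : Maybe Formula) →
         C⊢ optional• Δ ⇒ just (A °) → C⊢ ⦅ Δ ⦆• ∷ Λ ⇒ just ((□ A) °)
  -- ◇• has one constructor for {Δ} an input block, where the output Π of Γ is
  -- arbitrary, and one for {Δ} an output block, where Γ has no output.
  ◇•ⁱ  : ∀ {Λ Π A} (Δ : Maybe Formula) →
         C⊢ A • ∷ optional• Δ ⇒ nothing → C⊢ (◇ A) • ∷ ⦅ Δ ⦆• ∷ Λ ⇒ Π
  ◇•ᵒ  : ∀ {Λ A B} →
         C⊢ [ A • ] ⇒ just (B °) → C⊢ (◇ A) • ∷ Λ ⇒ just ⦅ B ⦆°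
  ◇°   : ∀ {Λ A} → C⊢ Λ ⇒ just ⦅ A ⦆° → C⊢ Λ ⇒ just ((◇ A) °)

{-# OPTIONS --safe #-}

-- Soundness reads an input block {A•} as □ A, the empty input block as □ (⊥ ⊃ ⊥)
-- and an output block {A°} as ◇ A.
--
-- Completeness needs no cut elimination: it is obtained by normalisation by
-- evaluation in a model whose worlds are the input contexts and in which
-- disjunctive and modal formulas are forced in continuation-passing style,
-- with cut-free derivability as answer type.  □ A is forced once some block {Δ}
-- of the context is itself, as a world, forcing A; ◇ A once some ◇ C is in the
-- context with the world C• forcing A.  Since the left rules discard their
-- principal formula, worlds are not ordered by inclusion but by letting a later
-- world contain the residues that left rules leave of the inputs of an earlier
-- one; this makes contraction unnecessary.

module Submission where

open import Defs
open import Data.Empty using () renaming (⊥ to Empty)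
open import Data.List.Base using (List; []; _∷_; [_])
open import Data.List.Membership.Propositional using (_∈_)
open import Data.List.Membership.Propositional.Properties using (∈-∃++)
open import Data.List.Relation.Binary.Permutation.Propositional
  using (_↭_; ↭-sym; ↭-trans; prep)
open import Data.List.Relation.Binary.Permutation.Propositional.Properties
  using (∈-resp-↭; shift)
open import Data.List.Relation.Binary.Subset.Propositional using (_⊆_)
open import Data.List.Relation.Unary.Any using (here; there)
open import Data.Maybe.Base using (Maybe; just; nothing)
open import Data.Product using (∃; _×_; _,_; proj₁; proj₂)
open import Data.Sum using (_⊎_; inj₁; inj₂; [_,_]′)
open import Function.Base using (_∘_) renaming (id to idᶠ)
open import Function.Bundles using (_⇔_; mk⇔)
open import Relation.Binary.PropositionalEquality
  using (_≡_; refl; sym; cong; cong₂) renaming (subst to transport)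

private
  variable
    A B   : Formula
    x     : Input
    Γ Γ′ Λ Λ′ : List Input
    Π     : Maybe Output

-- Soundness

content : Maybe Formula → Formula
content nothing  = ⊥ ⊃ ⊥
content (just A) = A

⌊_⌋ : Input → Formula
⌊ A • ⌋    = A
⌊ ⦅ Δ ⦆• ⌋ = □ content Δ

⌈_⌉ : Maybe Output → Formula
⌈ nothing ⌉         = ⊥
⌈ just (A °) ⌉      = A
⌈ just ⦅ A ⦆° ⌉     = ◇ A

infix 4 _⊢_

-- The modal and substitution rules act only inside `thm`, hence without hypotheses; this is what
-- makes `deduction` hold.
data _⊢_ (Λ : List Input) : Formula → Set where
  hyp : x ∈ Λ → Λ ⊢ ⌊ x ⌋
  thm : WM⊢ A → Λ ⊢ A
  app : Λ ⊢ A ⊃ B → Λ ⊢ A → Λ ⊢ B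

bind : (∀ {x} → x ∈ Λ → Λ′ ⊢ ⌊ x ⌋) → Λ ⊢ A → Λ′ ⊢ A
bind s (hyp m)   = s m
bind s (thm t)   = thm t
bind s (app f a) = app (bind s f) (bind s a)

bind-∷ : Λ ⊢ ⌊ x ⌋ → (∀ {y} → y ∈ Λ′ → Λ ⊢ ⌊ y ⌋) → ∀ {y} → y ∈ x ∷ Λ′ → Λ ⊢ ⌊ y ⌋
bind-∷ t s (here refl) = t
bind-∷ t s (there m)   = s m

⊃-refl : WM⊢ A ⊃ A
⊃-refl {A} = mp (mp ⊃-s ⊃-k) (⊃-k {B = A})

deduction : x ∷ Λ ⊢ B → Λ ⊢ ⌊ x ⌋ ⊃ B
deduction (hyp (here refl)) = thm ⊃-refl
deduction (hyp (there m))   = app (thm ⊃-k) (hyp m)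
deduction (thm t)           = thm (mp ⊃-k t)
deduction (app f a)         = app (app (thm ⊃-s) (deduction f)) (deduction a)

[]⊢⇒WM⊢ : [] ⊢ A → WM⊢ A
[]⊢⇒WM⊢ (thm t)   = t
[]⊢⇒WM⊢ (app f a) = mp ([]⊢⇒WM⊢ f) ([]⊢⇒WM⊢ a)

hyp-there : ∀ {x y} → y ∈ Λ → x ∷ Λ ⊢ ⌊ y ⌋
hyp-there m = hyp (there m)

⊥⊢ : Λ ⊢ ⊥ → Λ ⊢ A
⊥⊢ = app (thm ⊥-e)

optional⊢content : ∀ Δ → Λ ⊢ content Δ → x ∈ optional• Δ → Λ ⊢ ⌊ x ⌋
optional⊢content (just A) t (here refl) = t

soundness : C⊢ Λ ⇒ Π → Λ ⊢ ⌈ Π ⌉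
soundness (exch p d)  = bind (hyp ∘ ∈-resp-↭ p) (soundness d)
soundness ⊥•          = ⊥⊢ (hyp (here refl))
soundness id          = hyp (here refl)
soundness (∧• d)      =
  bind (bind-∷ (app (thm ∧-e₁) (hyp (here refl)))
       (bind-∷ (app (thm ∧-e₂) (hyp (here refl))) hyp-there)) (soundness d)
soundness (∧° d e)    = app (app (thm ∧-i) (soundness d)) (soundness e)
soundness (∨• d e)    =
  app (app (app (thm ∨-e) (bind hyp-there (deduction (soundness d))))
                          (bind hyp-there (deduction (soundness e))))
      (hyp (here refl))
soundness (∨°₁ d)     = app (thm ∨-i₁) (soundness d)
soundness (∨°₂ d)     = app (thm ∨-i₂) (soundness d)
soundness (⊃• d e)    =
  bind (bind-∷ (app (hyp (here refl)) (soundness d)) hyp-there) (soundness e)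
soundness (⊃° d)      = deduction (soundness d)
soundness (□• d)      = bind (bind-∷ (hyp (here refl)) hyp-there) (soundness d)
soundness (□° {A = A} Δ d) = app (thm (□-mono Δ⊃A)) (hyp (here refl))
  where
  Δ⊃A : WM⊢ content Δ ⊃ A
  Δ⊃A = []⊢⇒WM⊢ (deduction
    (bind (optional⊢content Δ (hyp {x = content Δ •} (here refl))) (soundness d)))
-- The premiss gives `A ⊃ ¬ content Δ`, so `◇ A` yields `◇ (¬ content Δ)`, which clashes with the
-- reading `□ content Δ` of the block.
soundness (◇•ⁱ {A = A} Δ d) =
  ⊥⊢ (app (thm □◇-⊥)
    (app (app (thm ∧-i) (hyp (there (here refl))))
         (app (thm (◇-mono A⊃¬Δ)) (hyp (here refl)))))
  where
  A⊃¬Δ : WM⊢ A ⊃ ¬ content Δ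
  A⊃¬Δ = []⊢⇒WM⊢ (deduction {x = A •} (deduction {x = content Δ •}
    (bind (bind-∷ (hyp (there (here refl)))
                  (optional⊢content Δ (hyp (here refl)))) (soundness d))))
soundness (◇•ᵒ d)     =
  app (thm (◇-mono ([]⊢⇒WM⊢ (deduction (soundness d))))) (hyp (here refl))
soundness (◇° d)      = soundness d

-- Worlds

infix 4 _▹_ _≼_

-- Besides `mem`, one constructor for each premiss in which a left rule trades its principal formula
-- for residues. The left premiss of `⊃•` keeps that formula, and the `◇•` rules leave the context
-- altogether.
data _▹_ (Γ : List Input) : Input → Set where
  mem : x ∈ Γ → Γ ▹ x
  ∧▹  : Γ ▹ A • → Γ ▹ B • → Γ ▹ (A ∧ B) •
  ∨▹₁ : Γ ▹ A • → Γ ▹ (A ∨ B) •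
  ∨▹₂ : Γ ▹ B • → Γ ▹ (A ∨ B) •
  ⊃▹  : Γ ▹ B • → Γ ▹ (A ⊃ B) •
  □▹  : Γ ▹ ⦅ just A ⦆• → Γ ▹ (□ A) •

_≼_ : List Input → List Input → Set
Γ ≼ Γ′ = ∀ {x} → Γ ▹ x → Γ′ ▹ x

∈▹⇒≼ : (∀ {x} → x ∈ Γ → Γ′ ▹ x) → Γ ≼ Γ′
∈▹⇒≼ s (mem m)  = s m
∈▹⇒≼ s (∧▹ a b) = ∧▹ (∈▹⇒≼ s a) (∈▹⇒≼ s b)
∈▹⇒≼ s (∨▹₁ a)  = ∨▹₁ (∈▹⇒≼ s a)
∈▹⇒≼ s (∨▹₂ b)  = ∨▹₂ (∈▹⇒≼ s b)
∈▹⇒≼ s (⊃▹ b)   = ⊃▹ (∈▹⇒≼ s b)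
∈▹⇒≼ s (□▹ a)   = □▹ (∈▹⇒≼ s a)

⊆⇒≼ : Γ ⊆ Γ′ → Γ ≼ Γ′
⊆⇒≼ s = ∈▹⇒≼ (mem ∘ s)

-- Makes the passage from the conclusion of a left rule to a premiss a step up in `≼`: the principal
-- input `x` is covered by its residues.
replace-≼ : Γ ↭ x ∷ Λ → Γ′ ▹ x → Λ ⊆ Γ′ → Γ ≼ Γ′
replace-≼ {x = x} {Λ = Λ} {Γ′ = Γ′} p t s = ∈▹⇒≼ (covered ∘ ∈-resp-↭ p)
  where
  covered : ∀ {y} → y ∈ x ∷ Λ → Γ′ ▹ y
  covered (here refl) = t
  covered (there m)   = mem (s m)

-- Inputs of this and the next three shapes arise only by `mem`, so they survive literally in all
-- later worlds.
▹⊥⇒∈ : Γ ▹ ⊥ • → ⊥ • ∈ Γ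
▹⊥⇒∈ (mem m) = m

▹var⇒∈ : ∀ {p} → Γ ▹ var p • → var p • ∈ Γ
▹var⇒∈ (mem m) = m

▹◇⇒∈ : Γ ▹ (◇ A) • → (◇ A) • ∈ Γ
▹◇⇒∈ (mem m) = m

▹block⇒∈ : ∀ {Δ} → Γ ▹ ⦅ Δ ⦆• → ⦅ Δ ⦆• ∈ Γ
▹block⇒∈ (mem m) = m

∈⇒↭∷ : x ∈ Γ → ∃ λ Λ → Γ ↭ x ∷ Λ
∈⇒↭∷ m with _ , _ , refl ← ∈-∃++ m = _ , shift _ _ _

-- Forcing

-- The output `Π` is chosen by the caller, so one computation can be run towards an output formula,
-- an output block or no output.
Cont : (List Input → Set) → List Input → Set
Cont P Γ = ∀ {Γ′} → Γ ≼ Γ′ → ∀ {Π} →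
           (∀ {Γ″} → Γ′ ≼ Γ″ → P Γ″ → C⊢ Γ″ ⇒ Π) → C⊢ Γ′ ⇒ Π

private
  variable
    P Q : List Input → Set

Cont-map : (∀ {Γ} → P Γ → Q Γ) → Cont P Γ → Cont Q Γ
Cont-map f c u k = c u (λ v → k v ∘ f)

Cont-join : Cont (Cont P) Γ → Cont P Γ
Cont-join c u k = c u (λ v c′ → c′ idᶠ (λ w → k (w ∘ v)))

infix 4 _⊩_

-- Atoms are forced under `Cont` too, so that `⊩-join` holds at every formula.
_⊩_ : List Input → Formula → Set
Γ ⊩ var p = Cont (var p • ∈_) Γ
Γ ⊩ ⊥     = Cont (λ _ → Empty) Γ
Γ ⊩ A ∧ B = (Γ ⊩ A) × (Γ ⊩ B)
Γ ⊩ A ∨ B = Cont (λ Γ′ → (Γ′ ⊩ A) ⊎ (Γ′ ⊩ B)) Γ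
Γ ⊩ A ⊃ B = ∀ {Γ′} → Γ ≼ Γ′ → Γ′ ⊩ A → Γ′ ⊩ B
Γ ⊩ □ A   = Cont (λ Γ′ → ∃ λ Δ → ⦅ Δ ⦆• ∈ Γ′ × (optional• Δ ⊩ A)) Γ
Γ ⊩ ◇ A   = Cont (λ Γ′ → ∃ λ C → (◇ C) • ∈ Γ′ × ([ C • ] ⊩ A)) Γ

⊩-mono : ∀ A → Γ ≼ Γ′ → Γ ⊩ A → Γ′ ⊩ A
⊩-mono (var p) u a v   = a (v ∘ u)
⊩-mono ⊥ u a v         = a (v ∘ u)
⊩-mono (A ∧ B) u (a , b) = ⊩-mono A u a , ⊩-mono B u b
⊩-mono (A ∨ B) u a v   = a (v ∘ u)
⊩-mono (A ⊃ B) u f v   = f (v ∘ u)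
⊩-mono (□ A) u a v     = a (v ∘ u)
⊩-mono (◇ A) u a v     = a (v ∘ u)

⊩-join : ∀ A → Cont (_⊩ A) Γ → Γ ⊩ A
⊩-join (var p) c       = Cont-join c
⊩-join ⊥ c             = Cont-join c
⊩-join (A ∧ B) c       = ⊩-join A (Cont-map proj₁ c) , ⊩-join B (Cont-map proj₂ c)
⊩-join (A ∨ B) c       = Cont-join c
⊩-join (A ⊃ B) c u a   = ⊩-join B λ v k →
  c (v ∘ u) (λ w f → k w (f idᶠ (⊩-mono A (w ∘ v) a)))
⊩-join (□ A) c         = Cont-join c
⊩-join (◇ A) c         = Cont-join c

mutual
  reify : ∀ A → Γ ⊩ A → C⊢ Γ ⇒ just (A °)
  reify (var p) a = a idᶠ λ _ m → let _ , p = ∈⇒↭∷ m in exch (↭-sym p) id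
  reify ⊥ a       = a idᶠ λ _ ()
  reify (A ∧ B) (a , b) = ∧° (reify A a) (reify B b)
  reify (A ∨ B) a = a idᶠ λ _ → [ ∨°₁ ∘ reify A , ∨°₂ ∘ reify B ]′
  reify (A ⊃ B) f = ⊃° (reify B (f (⊆⇒≼ there) (reflect A (mem (here refl)))))
  reify (□ A) a   = a idᶠ λ where
    _ (Δ , m , a′) → let _ , p = ∈⇒↭∷ m in exch (↭-sym p) (□° Δ (reify A a′))
  -- Applying `◇°` first makes the output a block, as the conclusion of `◇•ᵒ` demands.
  reify (◇ A) a   = ◇° (a idᶠ λ where
    _ (C , m , a′) → let _ , p = ∈⇒↭∷ m in exch (↭-sym p) (◇•ᵒ (reify A a′)))

  -- At a later world `A` may already be decomposed; its residues then supply the forcing, and a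
  -- left rule is applied only in case `mem`.
  reflect : ∀ A → Γ ▹ A • → Γ ⊩ A
  reflect (var p) t u k = k idᶠ (▹var⇒∈ (u t))
  reflect ⊥ t u k       = let _ , p = ∈⇒↭∷ (▹⊥⇒∈ (u t)) in exch (↭-sym p) ⊥•
  reflect {Γ} (A ∧ B) t = ⊩-join (A ∧ B) λ u k → split (u t) k
    where
    split : Γ′ ▹ (A ∧ B) • →
            (∀ {Γ″} → Γ′ ≼ Γ″ → Γ″ ⊩ A ∧ B → C⊢ Γ″ ⇒ Π) → C⊢ Γ′ ⇒ Π
    split (∧▹ a b) k = k idᶠ (reflect A a , reflect B b)
    split (mem m) k  = let _ , p = ∈⇒↭∷ m in exch (↭-sym p) (∧•
      (k (replace-≼ p (∧▹ (mem (here refl)) (mem (there (here refl)))) (there ∘ there))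
         (reflect A (mem (here refl)) , reflect B (mem (there (here refl))))))
  reflect (A ∨ B) t u k with u t
  ... | ∨▹₁ a = k idᶠ (inj₁ (reflect A a))
  ... | ∨▹₂ b = k idᶠ (inj₂ (reflect B b))
  ... | mem m = let _ , p = ∈⇒↭∷ m in exch (↭-sym p) (∨•
      (k (replace-≼ p (∨▹₁ (mem (here refl))) there) (inj₁ (reflect A (mem (here refl)))))
      (k (replace-≼ p (∨▹₂ (mem (here refl))) there) (inj₂ (reflect B (mem (here refl))))))
  reflect (A ⊃ B) t u a = ⊩-join B λ v k → split (v (u t)) (⊩-mono A v a) k
    where
    split : Γ′ ▹ (A ⊃ B) • → Γ′ ⊩ A →
            (∀ {Γ″} → Γ′ ≼ Γ″ → Γ″ ⊩ B → C⊢ Γ″ ⇒ Π) → C⊢ Γ′ ⇒ Π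
    split (⊃▹ b) a k  = k idᶠ (reflect B b)
    split (mem m) a k = let _ , p = ∈⇒↭∷ m in exch (↭-sym p) (⊃•
      -- The left premiss retains the implication, so it is the current world up to permutation,
      -- where `a` already forces `A`.
      (exch p (reify A a))
      (k (replace-≼ p (⊃▹ (mem (here refl))) there) (reflect B (mem (here refl)))))
  reflect (□ A) t u k with u t
  ... | □▹ a  = k idᶠ (just A , ▹block⇒∈ a , reflect A (mem (here refl)))
  ... | mem m = let _ , p = ∈⇒↭∷ m in exch (↭-sym p) (□•
      (k (replace-≼ p (□▹ (mem (here refl))) there)
         (just A , here refl , reflect A (mem (here refl)))))
  reflect (◇ A) t u k = k idᶠ (A , ▹◇⇒∈ (u t) , reflect A (mem (here refl)))

-- Completeness

⊩⊥-elim : ∀ A → Γ ⊩ ⊥ → Γ ⊩ A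
⊩⊥-elim A e = ⊩-join A λ u k → e u λ _ ()

◇-block-∈ : ∀ {Δ} → (◇ A) • ∈ Γ → ⦅ Δ ⦆• ∈ Γ →
            ∃ λ Λ → Γ ↭ (◇ A) • ∷ ⦅ Δ ⦆• ∷ Λ
◇-block-∈ m n with _ , p ← ∈⇒↭∷ m | ∈-resp-↭ p n
... | there n′ = let _ , q = ∈⇒↭∷ n′ in _ , ↭-trans p (prep _ q)

-- The block found by running `b` persists to the world where `d` finds `◇ C`. There `◇•ⁱ` applies,
-- and its premiss world lies above both `[ C • ]` and `optional• Δ`.
⊩-□◇-⊥ : ∀ A → Γ ⊩ □ A → Γ ⊩ ◇ (¬ A) → Γ ⊩ ⊥
⊩-□◇-⊥ A b d u k = b u λ { v (Δ , Δ∈ , a) → d (v ∘ u) λ { w (C , C∈ , f) →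
  let _ , p = ◇-block-∈ C∈ (▹block⇒∈ (w (mem Δ∈)))
  in exch (↭-sym p) (◇•ⁱ Δ
       (f (⊆⇒≼ λ { (here e) → here e }) (⊩-mono A (⊆⇒≼ there) a) idᶠ λ _ ())) } }

[]ˢ-∘ : ∀ A {σ τ} → A [ σ ]ˢ [ τ ]ˢ ≡ A [ (λ p → σ p [ τ ]ˢ) ]ˢ
[]ˢ-∘ (var p) = refl
[]ˢ-∘ ⊥       = refl
[]ˢ-∘ (A ∧ B) = cong₂ _∧_ ([]ˢ-∘ A) ([]ˢ-∘ B)
[]ˢ-∘ (A ∨ B) = cong₂ _∨_ ([]ˢ-∘ A) ([]ˢ-∘ B)
[]ˢ-∘ (A ⊃ B) = cong₂ _⊃_ ([]ˢ-∘ A) ([]ˢ-∘ B)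
[]ˢ-∘ (□ A)   = cong □_ ([]ˢ-∘ A)
[]ˢ-∘ (◇ A)   = cong ◇_ ([]ˢ-∘ A)

[]ˢ-var : ∀ A → A [ var ]ˢ ≡ A
[]ˢ-var (var p) = refl
[]ˢ-var ⊥       = refl
[]ˢ-var (A ∧ B) = cong₂ _∧_ ([]ˢ-var A) ([]ˢ-var B)
[]ˢ-var (A ∨ B) = cong₂ _∨_ ([]ˢ-var A) ([]ˢ-var B)
[]ˢ-var (A ⊃ B) = cong₂ _⊃_ ([]ˢ-var A) ([]ˢ-var B)
[]ˢ-var (□ A)   = cong □_ ([]ˢ-var A)
[]ˢ-var (◇ A)   = cong ◇_ ([]ˢ-var A)

-- Forcing treats variables as atoms, so the substitution rule is only sound for
-- validity under all substitution instances.
WM⊢⇒⊩ : WM⊢ A → ∀ σ → Γ ⊩ A [ σ ]ˢ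
WM⊢⇒⊩ (⊃-k {A}) σ u a v b = ⊩-mono (A [ σ ]ˢ) v a
WM⊢⇒⊩ ⊃-s σ u f v g w a = f (w ∘ v) a idᶠ (g w a)
WM⊢⇒⊩ (∧-i {A}) σ u a v b = ⊩-mono (A [ σ ]ˢ) v a , b
WM⊢⇒⊩ ∧-e₁ σ u (a , b) = a
WM⊢⇒⊩ ∧-e₂ σ u (a , b) = b
WM⊢⇒⊩ (∨-i₁ {A}) σ u a v k = k idᶠ (inj₁ (⊩-mono (A [ σ ]ˢ) v a))
WM⊢⇒⊩ (∨-i₂ {B = B}) σ u b v k = k idᶠ (inj₂ (⊩-mono (B [ σ ]ˢ) v b))
WM⊢⇒⊩ (∨-e {C = C}) σ u f v g w c = ⊩-join (C [ σ ]ˢ) λ r k →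
  c r λ s → [ k s ∘ f (s ∘ r ∘ w ∘ v) , k s ∘ g (s ∘ r ∘ w) ]′
WM⊢⇒⊩ (⊥-e {A}) σ u e = ⊩⊥-elim (A [ σ ]ˢ) e
WM⊢⇒⊩ (□◇-⊥ {A}) σ u (b , d) = ⊩-□◇-⊥ (A [ σ ]ˢ) b d
-- The induction hypothesis covers all worlds, in particular the inner world `optional• Δ`; likewise
-- `[ C • ]` for `◇-mono`.
WM⊢⇒⊩ (□-mono t) σ u b v k =
  b v λ { w (Δ , m , a) → k w (Δ , m , WM⊢⇒⊩ t σ idᶠ a) }
WM⊢⇒⊩ (◇-mono t) σ u d v k =
  d v λ { w (C , m , a) → k w (C , m , WM⊢⇒⊩ t σ idᶠ a) }
WM⊢⇒⊩ (mp s t) σ = WM⊢⇒⊩ s σ idᶠ (WM⊢⇒⊩ t σ)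
WM⊢⇒⊩ {Γ = Γ} (subst {A} τ t) σ =
  transport (Γ ⊩_) (sym ([]ˢ-∘ A)) (WM⊢⇒⊩ t (λ p → τ p [ σ ]ˢ))

mainTheorem6 : ∀ (φ : Formula) → (WM⊢ φ) ⇔ (C⊢ ([] ⇒ just (φ °)))
mainTheorem6 φ = mk⇔
  (λ t → reify φ (transport ([] ⊩_) ([]ˢ-var φ) (WM⊢⇒⊩ t var)))
  (λ d → []⊢⇒WM⊢ (soundness d))
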